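{- $\mathsf{LC}+\Box\bot$ is conservative over $\mathsf{IPC}$ for non-modal propositions: for every non-modal proposition $A$, if $\mathsf{LC}+\Box\bot\vdash A$ then $\mathsf{IPC}\vdash A$.
   Context: Modal language: propositional variables, $\bot$, $\wedge,\vee,\to$, $\Box$; non-modal propositions are those without $\Box$. $\mathsf{iGL}$: intuitionistic propositional logic in the modal language plus $\Box(A\to B)\to(\Box A\to\Box B)$, $\Box A\to\Box\Box A$, $\Box(\Box A\to A)\to\Box A$, closed under modus ponens and necessitation. $\mathsf{LC}:=\mathsf{iGL}+\{A\to\Box A\}$; $\mathsf{LC}+\Box\bot$ adds the axiom $\Box\bot$. -}

module Defs where

open import Data.Nat.Base using (ℕ)
open import Level using (0ℓ)
open import Relation.Unary using (Pred; _∈_; _∩_; _∪_; ｛_｝)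

infix  9 □_
infixr 7 _∧_
infixr 6 _∨_
infixr 5 _⇒_

data Form : Set where
  var         : ℕ → Form
  ⊥′          : Form
  _∧_ _∨_ _⇒_ : Form → Form → Form
  □_          : Form → Form

data NonModal : Pred Form 0ℓ where
  var : ∀ n → NonModal (var n)
  ⊥′  : NonModal ⊥′
  _∧_ : ∀ {A B} → NonModal A → NonModal B → NonModal (A ∧ B)
  _∨_ : ∀ {A B} → NonModal A → NonModal B → NonModal (A ∨ B)
  _⇒_ : ∀ {A B} → NonModal A → NonModal B → NonModal (A ⇒ B)

data IntAxiom : Pred Form 0ℓ where
  K   : ∀ A B   → IntAxiom (A ⇒ B ⇒ A)
  S   : ∀ A B C → IntAxiom ((A ⇒ B ⇒ C) ⇒ (A ⇒ B) ⇒ A ⇒ C)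
  ∧I  : ∀ A B   → IntAxiom (A ⇒ B ⇒ A ∧ B)
  ∧E₁ : ∀ A B   → IntAxiom (A ∧ B ⇒ A)
  ∧E₂ : ∀ A B   → IntAxiom (A ∧ B ⇒ B)
  ∨I₁ : ∀ A B   → IntAxiom (A ⇒ A ∨ B)
  ∨I₂ : ∀ A B   → IntAxiom (B ⇒ A ∨ B)
  ∨E  : ∀ A B C → IntAxiom ((A ⇒ C) ⇒ (B ⇒ C) ⇒ A ∨ B ⇒ C)
  ⊥E  : ∀ A     → IntAxiom (⊥′ ⇒ A)

data ModalAxiom : Pred Form 0ℓ where
  distribution : ∀ A B → ModalAxiom (□ (A ⇒ B) ⇒ □ A ⇒ □ B)
  transitivity : ∀ A   → ModalAxiom (□ A ⇒ □ □ A)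
  löb          : ∀ A   → ModalAxiom (□ (□ A ⇒ A) ⇒ □ A)

data CompletenessAxiom : Pred Form 0ℓ where
  completeness : ∀ A → CompletenessAxiom (A ⇒ □ A)

data PropClosure (X : Pred Form 0ℓ) : Pred Form 0ℓ where
  axiom : ∀ {A} → A ∈ X → PropClosure X A
  mp    : ∀ {A B} → PropClosure X (A ⇒ B) → PropClosure X A → PropClosure X B

data ModalClosure (X : Pred Form 0ℓ) : Pred Form 0ℓ where
  axiom : ∀ {A} → A ∈ X → ModalClosure X A
  mp    : ∀ {A B} → ModalClosure X (A ⇒ B) → ModalClosure X A → ModalClosure X B
  nec   : ∀ {A} → ModalClosure X A → ModalClosure X (□ A)

-- A logic is identified with its set of theorems.
Logic : Set₁
Logic = Pred Form 0ℓ

infix  3 _⊢_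
infixl 4 _+_

_⊢_ : Logic → Form → Set
L ⊢ A = A ∈ L

_+_ : Logic → Pred Form 0ℓ → Logic
L + X = ModalClosure (L ∪ X)

-- IPC is the logic of the □-free language: only □-free axiom instances are
-- admitted, hence every formula occurring in a derivation is □-free.
IPC : Logic
IPC = PropClosure (IntAxiom ∩ NonModal)

-- Here the intuitionistic schemes range over the full modal language.
iGL : Logic
iGL = ModalClosure (IntAxiom ∪ ModalAxiom)

LC : Logic
LC = iGL + CompletenessAxiom

LC+□⊥ : Logic
LC+□⊥ = LC + ｛ □ ⊥′ ｝

{-# OPTIONS --safe #-}

-- Reading every boxed formula as a truth (⊥ ⇒ ⊥) validates all the modal axioms,
-- completeness, □⊥ and necessitation in IPC, and leaves □-free formulas unchanged.
module Submission where

open import Defs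
open import Data.Product.Base using (_,_)
open import Data.Sum.Base using ([_,_])
open import Relation.Binary.PropositionalEquality.Core using (_≡_; refl; cong₂; subst)
open import Relation.Unary using (Pred; _∈_; _⊆_; ｛_｝)

-- Over `□ ⊥′` every boxed formula is provable, so `□` carries no information and can be collapsed
-- to `⊤′`. Semantically, this is an intuitionistic Kripke model with empty modal relation. The
-- collapse `erase` turns derivations in `LC+□⊥` into `IPC` theorems (`erase-LC+□⊥`) and fixes
-- non-modal formulas (`erase-id`).

⊤′ : Form
⊤′ = ⊥′ ⇒ ⊥′

erase : Form → Form
erase (var n) = var n
erase ⊥′      = ⊥′
erase (A ∧ B) = erase A ∧ erase B
erase (A ∨ B) = erase A ∨ erase B
erase (A ⇒ B) = erase A ⇒ erase B
erase (□ _)   = ⊤′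

-- `IPC` admits only □-free axiom instances, so each erased axiom needs this certificate.
erase-nonModal : ∀ A → NonModal (erase A)
erase-nonModal (var n) = var n
erase-nonModal ⊥′      = ⊥′
erase-nonModal (A ∧ B) = erase-nonModal A ∧ erase-nonModal B
erase-nonModal (A ∨ B) = erase-nonModal A ∨ erase-nonModal B
erase-nonModal (A ⇒ B) = erase-nonModal A ⇒ erase-nonModal B
erase-nonModal (□ _)   = ⊥′ ⇒ ⊥′

erase-id : ∀ {A} → NonModal A → erase A ≡ A
erase-id (var n) = refl
erase-id ⊥′      = refl
erase-id (a ∧ b) = cong₂ _∧_ (erase-id a) (erase-id b)
erase-id (a ∨ b) = cong₂ _∨_ (erase-id a) (erase-id b)
erase-id (a ⇒ b) = cong₂ _⇒_ (erase-id a) (erase-id b)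

IPC-⊤ : ⊤′ ∈ IPC
IPC-⊤ = axiom (⊥E ⊥′ , ⊥′ ⇒ ⊥′)

IPC-weaken : ∀ {A B} → NonModal A → NonModal B → A ∈ IPC → (B ⇒ A) ∈ IPC
IPC-weaken a b = mp (axiom (K _ _ , a ⇒ b ⇒ a))

IPC-⇒⊤ : ∀ {A} → NonModal A → (A ⇒ ⊤′) ∈ IPC
IPC-⇒⊤ a = IPC-weaken (⊥′ ⇒ ⊥′) a IPC-⊤

ErasesToIPC : Pred Form _
ErasesToIPC A = erase A ∈ IPC

-- `erase` commutes with the connectives, so an instance goes to an instance of the same scheme.
erase-IntAxiom : IntAxiom ⊆ ErasesToIPC
erase-IntAxiom {A} x = axiom (image x , erase-nonModal A)
  where
  image : ∀ {A} → IntAxiom A → IntAxiom (erase A)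
  image (K _ _)    = K _ _
  image (S _ _ _)  = S _ _ _
  image (∧I _ _)   = ∧I _ _
  image (∧E₁ _ _)  = ∧E₁ _ _
  image (∧E₂ _ _)  = ∧E₂ _ _
  image (∨I₁ _ _)  = ∨I₁ _ _
  image (∨I₂ _ _)  = ∨I₂ _ _
  image (∨E _ _ _) = ∨E _ _ _
  image (⊥E _)     = ⊥E _

-- Each modal axiom is a chain of implications ending in a boxed formula, hence erases to one ending
-- in `⊤′`.
erase-ModalAxiom : ModalAxiom ⊆ ErasesToIPC
erase-ModalAxiom (distribution _ _) =
  IPC-weaken ((⊥′ ⇒ ⊥′) ⇒ ⊥′ ⇒ ⊥′) (⊥′ ⇒ ⊥′) (IPC-⇒⊤ (⊥′ ⇒ ⊥′))
erase-ModalAxiom (transitivity _)   = IPC-⇒⊤ (⊥′ ⇒ ⊥′)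
erase-ModalAxiom (löb _)            = IPC-⇒⊤ (⊥′ ⇒ ⊥′)

erase-CompletenessAxiom : CompletenessAxiom ⊆ ErasesToIPC
erase-CompletenessAxiom (completeness A) = IPC-⇒⊤ (erase-nonModal A)

erase-□⊥ : ｛ □ ⊥′ ｝ ⊆ ErasesToIPC
erase-□⊥ refl = IPC-⊤

-- Stated for arbitrary `X` because the logics are nested: the theorems of each one serve as axioms
-- of the next.
erase-ModalClosure : ∀ {X} → X ⊆ ErasesToIPC → ModalClosure X ⊆ ErasesToIPC
erase-ModalClosure h (axiom x) = h x
erase-ModalClosure h (mp d e)  = mp (erase-ModalClosure h d) (erase-ModalClosure h e)
-- Necessitation concludes a boxed formula, which erases to `⊤′`.
erase-ModalClosure h (nec _)   = IPC-⊤

erase-iGL : iGL ⊆ ErasesToIPC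
erase-iGL = erase-ModalClosure [ erase-IntAxiom , erase-ModalAxiom ]

erase-LC : LC ⊆ ErasesToIPC
erase-LC = erase-ModalClosure [ erase-iGL , erase-CompletenessAxiom ]

erase-LC+□⊥ : LC+□⊥ ⊆ ErasesToIPC
erase-LC+□⊥ = erase-ModalClosure [ erase-LC , erase-□⊥ ]

theorem4p27 : ∀ (A : Form) → NonModal A → LC+□⊥ ⊢ A → IPC ⊢ A
theorem4p27 A a d = subst IPC (erase-id a) (erase-LC+□⊥ d)
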